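{- For every $n\ge 1$, the set $\mathcal{A}_n$ of arc permutations in the symmetric group $\mathcal{S}_n$ satisfies $$\mathcal{A}_n=\mathcal{S}_n(1324,1342,2413,2431,3124,3142,4213,4231).$$
   Context: Permutations $\pi\in\mathcal{S}_n$ are written in one-line notation $\pi=\pi(1)\pi(2)\cdots\pi(n)$. An interval in $\mathbb{Z}_n$ is a subset of $\{1,\dots,n\}$ of the form $[a,b]=\{a,a+1,\dots,b\}$ or $[b,n]\cup[1,a]$ for some $1\le a\le b\le n$. A permutation $\pi\in\mathcal{S}_n$ is an arc permutation if for every $1\le j\le n$ the set $\{\pi(1),\dots,\pi(j)\}$ is an interval in $\mathbb{Z}_n$; $\mathcal{A}_n$ is the set of arc permutations in $\mathcal{S}_n$. For patterns $\tau_1,\tau_2,\dots$ (permutations in one-line notation), $\mathcal{S}_n(\tau_1,\tau_2,\dots)$ denotes the set of permutations in $\mathcal{S}_n$ that avoid all of the $\tau_i$, i.e. that contain no (not necessarily contiguous) subsequence whose entries are in the same relative order as those of $\tau_i$. -}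

module Defs where

open import Data.Fin using (Fin; _≤_; _<_)
open import Data.Fin.Patterns using ()
  renaming (0F to #1; 1F to #2; 2F to #3; 3F to #4)
open import Data.Fin.Permutation using (Permutation′; permutation; _⟨$⟩ʳ_)
open import Data.Fin.Properties using (_≟_; all?; any?)
open import Data.List using (List; []; _∷_)
open import Data.List.Relation.Unary.All using (All)
open import Data.Nat using (ℕ)
open import Data.Product using (∃; ∃₂; _×_; _,_; proj₁; proj₂)
open import Data.Sum using (_⊎_)
open import Data.Vec using (Vec; []; _∷_; lookup)
open import Function.Bundles using (_⇔_)
open import Level using (0ℓ)
open import Relation.Binary.PropositionalEquality using (_≡_; refl; sym)
open import Relation.Nullary using (¬_; Dec)
open import Relation.Nullary.Decidable using (True; toWitness; _×-dec_; _→-dec_)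
open import Relation.Unary using (Pred; _∪_; _≐_)

-- Positions and values 1, …, n are represented by Fin n, shifted down by one.

[_,_] : ∀ {n} → Fin n → Fin n → Pred (Fin n) 0ℓ
[ a , b ] x = a ≤ x × x ≤ b

[_,n] : ∀ {n} → Fin n → Pred (Fin n) 0ℓ
[ b ,n] x = b ≤ x

[1,_] : ∀ {n} → Fin n → Pred (Fin n) 0ℓ
[1, a ] x = x ≤ a

IsInterval : ∀ {n} → Pred (Fin n) 0ℓ → Set
IsInterval S = ∃₂ λ a b → a ≤ b × (S ≐ [ a , b ] ⊎ S ≐ ([ b ,n] ∪ [1, a ]))

-- { π(1), …, π(j) }
Prefix : ∀ {n} → Permutation′ n → Fin n → Pred (Fin n) 0ℓ
Prefix π j x = ∃ λ i → i ≤ j × π ⟨$⟩ʳ i ≡ x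

𝒜 : ∀ n → Pred (Permutation′ n) 0ℓ
𝒜 n π = (j : Fin n) → IsInterval (Prefix π j)

-- The function e lists the positions of the subsequence.
Contains : ∀ {n k} → Permutation′ n → Permutation′ k → Set
Contains {n} {k} π τ = ∃ λ (e : Fin k → Fin n) →
  (∀ i j → i < j → e i < e j) ×
  (∀ i j → (π ⟨$⟩ʳ e i < π ⟨$⟩ʳ e j) ⇔ (τ ⟨$⟩ʳ i < τ ⟨$⟩ʳ j))

Pattern : Set
Pattern = ∃ λ k → Permutation′ k

𝒮 : ∀ n → List Pattern → Pred (Permutation′ n) 0ℓ
𝒮 n τs π = All (λ τ → ¬ Contains π (proj₂ τ)) τs

-- Every value occurs exactly once in the word.
IsOneLine : ∀ {k} → Vec (Fin k) k → Set
IsOneLine {k} w = ∀ (v : Fin k) → ∃ λ i →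
  lookup w i ≡ v × (∀ j → lookup w j ≡ v → j ≡ i)

isOneLine? : ∀ {k} (w : Vec (Fin k) k) → Dec (IsOneLine w)
isOneLine? w = all? λ v → any? λ i →
  (lookup w i ≟ v) ×-dec all? λ j → (lookup w j ≟ v) →-dec (j ≟ i)

oneLine : ∀ {k} (w : Vec (Fin k) k) {_ : True (isOneLine? w)} → Permutation′ k
oneLine w {t} = permutation (lookup w) (λ v → proj₁ (occ v))
  (λ v → proj₁ (proj₂ (occ v)))
  (λ i → sym (proj₂ (proj₂ (occ (lookup w i))) i refl))
  where
  occ : IsOneLine w
  occ = toWitness t

-- #1, …, #4 are the elements of Fin 4 named by the values they stand for.
p1324 p1342 p2413 p2431 p3124 p3142 p4213 p4231 : Pattern
p1324 = 4 , oneLine (#1 ∷ #3 ∷ #2 ∷ #4 ∷ [])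
p1342 = 4 , oneLine (#1 ∷ #3 ∷ #4 ∷ #2 ∷ [])
p2413 = 4 , oneLine (#2 ∷ #4 ∷ #1 ∷ #3 ∷ [])
p2431 = 4 , oneLine (#2 ∷ #4 ∷ #3 ∷ #1 ∷ [])
p3124 = 4 , oneLine (#3 ∷ #1 ∷ #2 ∷ #4 ∷ [])
p3142 = 4 , oneLine (#3 ∷ #1 ∷ #4 ∷ #2 ∷ [])
p4213 = 4 , oneLine (#4 ∷ #2 ∷ #1 ∷ #3 ∷ [])
p4231 = 4 , oneLine (#4 ∷ #2 ∷ #3 ∷ #1 ∷ [])

{-# OPTIONS --safe #-}

-- Call a set of values crossing if it contains one of the pairs {w, y}, {x, z} for some
-- w < x < y < z, and is disjoint from the other pair.  The eight patterns are exactly the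
-- permutations of size 4 whose first two values form a crossing set, so π avoids all of them iff
-- no prefix of π is crossing, and a nonempty set is an interval in ℤₙ iff it is not crossing.

module Submission where

open import Defs
open import Data.Fin using (Fin; zero; suc; _≤_; _<_)
open import Data.Fin.Patterns using (0F; 1F; 2F; 3F)
open import Data.Fin.Permutation using (Permutation′; _⟨$⟩ʳ_; _⟨$⟩ˡ_; inverseˡ; inverseʳ)
open import Data.Fin.Properties
  using (any?; _≟_; _≤?_; _<?_; <-cmp; <-trans; <-irrefl; ≤∧≢⇒<)
open import Data.List using (List; []; _∷_)
open import Data.List.Relation.Unary.All as All using (All; []; _∷_)
open import Data.List.Relation.Unary.All.Properties using (All¬⇒¬Any)
open import Data.List.Relation.Unary.Any using (Any; here; there)
open import Data.Nat using (ℕ; _≥_; z≤n; s≤s)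
open import Data.Nat.Properties using (≤-refl; ≤-trans; <⇒≤; <⇒≱; ≰⇒>; ≤-<-trans)
open import Data.Product using (∃; _×_; _,_; proj₂)
open import Data.Sum using (_⊎_; inj₁; inj₂)
open import Data.Vec using (Vec; []; _∷_; lookup; map; tabulate)
open import Data.Vec.Properties using (lookup∘tabulate)
open import Data.Vec.Relation.Unary.Linked as Linked using (Linked; [-]; _∷_)
open import Data.Vec.Relation.Unary.Linked.Properties using (lookup⁺; map⁺)
open import Function using (_∘_)
open import Function.Bundles using (_⇔_; mk⇔; Equivalence)
open import Level using (0ℓ)
open import Relation.Binary using (tri<; tri≈; tri>)
open import Relation.Binary.PropositionalEquality
  using (refl; sym; trans; cong; subst; subst₂)
open import Relation.Nullary using (¬_; yes; no; contradiction)
open import Relation.Nullary.Decidable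
  using (True; toWitness; decidable-stable; map′; _×-dec_; _⊎-dec_; ¬?)
open import Relation.Unary using (Pred; Decidable; _≐_)

open Equivalence using (to; from)

least : ∀ {n p} {P : Pred (Fin n) p} → Decidable P → ∃ P →
  ∃ λ a → P a × (∀ x → P x → a ≤ x)
least {ℕ.suc n} P? (i , p) with P? zero
... | yes p₀ = zero , p₀ , λ _ _ → z≤n
least P? (zero  , p) | no ¬p₀ = contradiction p ¬p₀
least P? (suc i , p) | no ¬p₀ with least (P? ∘ suc) (i , p)
... | a , pa , min = suc a , pa , λ where
  zero    p₀ → contradiction p₀ ¬p₀
  (suc x) px → s≤s (min x px)

greatest : ∀ {n p} {P : Pred (Fin n) p} → Decidable P → ∃ P →
  ∃ λ b → P b × (∀ x → P x → x ≤ b)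
greatest {ℕ.suc n} P? (i , p) with any? (P? ∘ suc)
... | yes ∃P with greatest (P? ∘ suc) ∃P
...   | b , pb , max = suc b , pb , λ where
  zero    _  → z≤n
  (suc x) px → s≤s (max x px)
greatest P? (zero  , p) | no ∄P = zero , p , λ where
  zero    _  → z≤n
  (suc x) px → contradiction (x , px) ∄P
greatest P? (suc i , p) | no ∄P = contradiction (i , p) ∄P

StrictlyMonotone : ∀ {m n} → (Fin m → Fin n) → Set
StrictlyMonotone f = ∀ i j → i < j → f i < f j

module _ {m n} {f : Fin m → Fin n} (mono : StrictlyMonotone f) where

  ≤-mono : ∀ i j → i ≤ j → f i ≤ f j
  ≤-mono i j i≤j with i ≟ j
  ... | yes refl = ≤-refl
  ... | no  i≢j  = <⇒≤ (mono i j (≤∧≢⇒< i≤j i≢j))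

  <-reflects : ∀ i j → f i < f j → i < j
  <-reflects i j fi<fj = ≰⇒> λ j≤i → <⇒≱ fi<fj (≤-mono j i j≤i)

  ≤-reflects : ∀ i j → f i ≤ f j → i ≤ j
  ≤-reflects i j fi≤fj with i ≤? j
  ... | yes i≤j = i≤j
  ... | no  i≰j = contradiction fi≤fj (<⇒≱ (mono j i (≰⇒> i≰j)))

module _ {n} (P : Pred (Fin n) 0ℓ) where

  Alternating : Vec (Fin n) 4 → Set
  Alternating (w ∷ x ∷ y ∷ z ∷ []) =
    (P w × ¬ P x × P y × ¬ P z) ⊎ (¬ P w × P x × ¬ P y × P z)

  Crossing : Set
  Crossing = ∃ λ v → Linked _<_ v × Alternating v

  alternating? : Decidable P → Decidable Alternating
  alternating? P? (w ∷ x ∷ y ∷ z ∷ []) =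
    (P? w ×-dec ¬? (P? x) ×-dec P? y ×-dec ¬? (P? z)) ⊎-dec
    (¬? (P? w) ×-dec P? x ×-dec ¬? (P? y) ×-dec P? z)

-- Crossing asserts non-membership as well as membership, so both directions of the equivalence are
-- used.
alternating-map : ∀ {m n} {P : Pred (Fin m) _} {Q : Pred (Fin n) 0ℓ} (f : Fin m → Fin n) →
  (∀ x → P x ⇔ Q (f x)) → ∀ v → Alternating P v → Alternating Q (map f v)
alternating-map f P⇔Q (w ∷ x ∷ y ∷ z ∷ []) (inj₁ (pw , ¬px , py , ¬pz)) =
  inj₁ (to (P⇔Q w) pw , ¬px ∘ from (P⇔Q x) , to (P⇔Q y) py , ¬pz ∘ from (P⇔Q z))
alternating-map f P⇔Q (w ∷ x ∷ y ∷ z ∷ []) (inj₂ (¬pw , px , ¬py , pz)) =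
  inj₂ (¬pw ∘ from (P⇔Q w) , to (P⇔Q x) px , ¬py ∘ from (P⇔Q y) , to (P⇔Q z) pz)

-- In `[ a , b ]` the value between the two members of the crossing is trapped. In a wrapped
-- interval, the inner member (`y` or `x`) lies in one of the two arms, and that arm swallows the
-- neighbour on its outer side.
interval⇒¬crossing : ∀ {n} {P : Pred (Fin n) 0ℓ} → IsInterval P → ¬ Crossing P
interval⇒¬crossing (a , b , _ , inj₁ (P⊆ , ⊆P))
  (w ∷ x ∷ y ∷ z ∷ [] , w<x ∷ x<y ∷ y<z ∷ [-] , inj₁ (pw , ¬px , py , ¬pz))
  with P⊆ pw | P⊆ py
... | a≤w , _ | _ , y≤b = ¬px (⊆P (≤-trans a≤w (<⇒≤ w<x) , ≤-trans (<⇒≤ x<y) y≤b))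
interval⇒¬crossing (a , b , _ , inj₁ (P⊆ , ⊆P))
  (w ∷ x ∷ y ∷ z ∷ [] , w<x ∷ x<y ∷ y<z ∷ [-] , inj₂ (¬pw , px , ¬py , pz))
  with P⊆ px | P⊆ pz
... | a≤x , _ | _ , z≤b = ¬py (⊆P (≤-trans a≤x (<⇒≤ x<y) , ≤-trans (<⇒≤ y<z) z≤b))
interval⇒¬crossing (a , b , _ , inj₂ (P⊆ , ⊆P))
  (w ∷ x ∷ y ∷ z ∷ [] , w<x ∷ x<y ∷ y<z ∷ [-] , inj₁ (pw , ¬px , py , ¬pz))
  with P⊆ py
... | inj₁ b≤y = ¬pz (⊆P (inj₁ (≤-trans b≤y (<⇒≤ y<z))))
... | inj₂ y≤a = ¬px (⊆P (inj₂ (≤-trans (<⇒≤ x<y) y≤a)))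
interval⇒¬crossing (a , b , _ , inj₂ (P⊆ , ⊆P))
  (w ∷ x ∷ y ∷ z ∷ [] , w<x ∷ x<y ∷ y<z ∷ [-] , inj₂ (¬pw , px , ¬py , pz))
  with P⊆ px
... | inj₁ b≤x = ¬py (⊆P (inj₁ (≤-trans b≤x (<⇒≤ x<y))))
... | inj₂ x≤a = ¬pw (⊆P (inj₂ (≤-trans (<⇒≤ w<x) x≤a)))

module _ {n} {P : Pred (Fin n) 0ℓ} (P? : Decidable P) where

  -- Separates the two shapes: an ordinary interval has no gap, so a set with a gap can only be an
  -- interval by wrapping around.
  Gap : Pred (Fin n) 0ℓ
  Gap r = ¬ P r × (∃ λ a → P a × a < r) × (∃ λ b → P b × r < b)

  gap? : Decidable Gap
  gap? r = ¬? (P? r) ×-dec any? (λ a → P? a ×-dec a <? r) ×-dec any? (λ b → P? b ×-dec r <? b)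

  ≤∧∈∧∉⇒< : ∀ {x y} → x ≤ y → P x → ¬ P y → x < y
  ≤∧∈∧∉⇒< x≤y px ¬py = ≤∧≢⇒< x≤y λ { refl → ¬py px }

  ≤∧∉∧∈⇒< : ∀ {x y} → x ≤ y → ¬ P x → P y → x < y
  ≤∧∉∧∈⇒< x≤y ¬px py = ≤∧≢⇒< x≤y λ { refl → ¬px py }

  -- The endpoints are the least and greatest members; any value missing between them would be a
  -- gap.
  gapless⇒interval : ∃ P → ¬ ∃ Gap → IsInterval P
  gapless⇒interval ∃P ∄gap with least P? ∃P | greatest P? ∃P
  ... | a , pa , min | b , pb , max = a , b , min b pb , inj₁
    ( (λ {x} px → min x px , max x px)
    , λ {x} (a≤x , x≤b) → decidable-stable (P? x) λ ¬px →
        ∄gap (x , ¬px , (a , pa , ≤∧∈∧∉⇒< a≤x pa ¬px) , (b , pb , ≤∧∉∧∈⇒< x≤b ¬px pb)))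

  -- With a the last element of P before the gap r and b the first one after it, a value outside P
  -- but in [b ,n] or [1, a ] would cross a, r, b.
  gap⇒interval : ¬ Crossing P → ∃ Gap → IsInterval P
  gap⇒interval ¬cross (r , ¬pr , before , after)
    with greatest (λ a → P? a ×-dec a <? r) before | least (λ b → P? b ×-dec r <? b) after
  ... | a , (pa , a<r) , max | b , (pb , r<b) , min =
    a , b , <⇒≤ (<-trans a<r r<b) , inj₂ (P⊆ , ⊆P)
    where
    P⊆ : ∀ {x} → P x → b ≤ x ⊎ x ≤ a
    P⊆ {x} px with <-cmp x r
    ... | tri< x<r _ _  = inj₂ (max x (px , x<r))
    ... | tri≈ _ refl _ = contradiction px ¬pr
    ... | tri> _ _ r<x  = inj₁ (min x (px , r<x))

    ⊆P : ∀ {x} → b ≤ x ⊎ x ≤ a → P x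
    ⊆P {x} (inj₁ b≤x) = decidable-stable (P? x) λ ¬px →
      ¬cross (a ∷ r ∷ b ∷ x ∷ [] , a<r ∷ r<b ∷ ≤∧∈∧∉⇒< b≤x pb ¬px ∷ [-] ,
              inj₁ (pa , ¬pr , pb , ¬px))
    ⊆P {x} (inj₂ x≤a) = decidable-stable (P? x) λ ¬px →
      ¬cross (x ∷ a ∷ r ∷ b ∷ [] , ≤∧∉∧∈⇒< x≤a ¬px pa ∷ a<r ∷ r<b ∷ [-] ,
              inj₂ (¬px , pa , ¬pr , pb))

  ¬crossing⇒interval : ∃ P → ¬ Crossing P → IsInterval P
  ¬crossing⇒interval ∃P ¬cross with any? gap?
  ... | yes gap  = gap⇒interval ¬cross gap
  ... | no  ∄gap = gapless⇒interval ∃P ∄gap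

-- Turns the existential into a comparison of the position of `x` with `j`, which is decidable and
-- can be chained with other inequalities of positions.
prefix⇔ : ∀ {n} (π : Permutation′ n) j x → (π ⟨$⟩ˡ x ≤ j) ⇔ Prefix π j x
prefix⇔ π j x = mk⇔ (λ p → π ⟨$⟩ˡ x , p , inverseʳ π)
  λ { (i , i≤j , refl) → subst (_≤ j) (sym (inverseˡ π)) i≤j }

prefix? : ∀ {n} (π : Permutation′ n) j → Decidable (Prefix π j)
prefix? π j x = map′ (to (prefix⇔ π j x)) (from (prefix⇔ π j x)) (π ⟨$⟩ˡ x ≤? j)

crossing-contains : ∀ {n k} {π : Permutation′ n} {τ : Permutation′ k} → Contains π τ →
  (∃ λ j → Crossing (Prefix τ j)) → ∃ λ j → Crossing (Prefix π j)
crossing-contains {π = π} {τ} (e , mono , iso) (j , v , v↗ , alt) =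
  e j , map f v , map⁺ (Linked.map (λ {x} {y} → f-mono x y) v↗) , alternating-map f prefix v alt
  where
  -- The value of `π` that plays the role of the value `x` of `τ` in the occurrence `e`.
  f = λ x → π ⟨$⟩ʳ e (τ ⟨$⟩ˡ x)

  f-mono : StrictlyMonotone f
  f-mono x y x<y = from (iso _ _) (subst₂ _<_ (sym (inverseʳ τ)) (sym (inverseʳ τ)) x<y)

  -- The prefix of `π` up to `e j` may hold further values, but on the image of `f` it agrees with
  -- the prefix of `τ`, since `e` preserves and reflects the order of positions.
  prefix : ∀ x → Prefix τ j x ⇔ Prefix π (e j) (f x)
  prefix x = mk⇔
    (λ p → _ , ≤-mono mono _ j (from (prefix⇔ τ j x) p) , refl)
    (λ p → to (prefix⇔ τ j x) (≤-reflects mono _ j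
      (subst (_≤ e j) (inverseˡ π) (from (prefix⇔ π (e j) (f x)) p))))

-- Builds an occurrence from its values in increasing order: `v` fixes the relative order of the
-- entries, so it remains to compare the positions of consecutive ones.
contains⁺ : ∀ {n k} (π : Permutation′ n) (τ : Permutation′ k) (v : Vec (Fin n) k) →
  Linked _<_ v → Linked _<_ (tabulate λ i → π ⟨$⟩ˡ lookup v (τ ⟨$⟩ʳ i)) → Contains π τ
contains⁺ π τ v v↗ e↗ = e , e-mono , iso
  where
  e = λ i → π ⟨$⟩ˡ lookup v (τ ⟨$⟩ʳ i)

  e-mono : StrictlyMonotone e
  e-mono i j i<j = subst₂ _<_ (lookup∘tabulate e i) (lookup∘tabulate e j)
    (lookup⁺ (λ {x} {y} {z} → <-trans {i = x} {y} {z}) e↗ i<j)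

  v-mono : StrictlyMonotone (lookup v)
  v-mono i j = lookup⁺ (λ {x} {y} {z} → <-trans {i = x} {y} {z}) v↗

  iso : ∀ i j → (π ⟨$⟩ʳ e i < π ⟨$⟩ʳ e j) ⇔ (τ ⟨$⟩ʳ i < τ ⟨$⟩ʳ j)
  iso i j = mk⇔
    (<-reflects v-mono _ _ ∘ subst₂ _<_ (inverseʳ π) (inverseʳ π))
    (subst₂ _<_ (sym (inverseʳ π)) (sym (inverseʳ π)) ∘ v-mono _ _)

patterns : List Pattern
patterns = p1324 ∷ p1342 ∷ p2413 ∷ p2431 ∷ p3124 ∷ p3142 ∷ p4213 ∷ p4231 ∷ []

patterns-crossing : All (λ τ → ∃ λ j → Crossing (Prefix (proj₂ τ) j)) patterns
patterns-crossing =
  crossing (proj₂ p1324) ∷ crossing (proj₂ p1342) ∷ crossing (proj₂ p2413) ∷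
  crossing (proj₂ p2431) ∷ crossing (proj₂ p3124) ∷ crossing (proj₂ p3142) ∷
  crossing (proj₂ p4213) ∷ crossing (proj₂ p4231) ∷ []
  where
  identity : Vec (Fin 4) 4
  identity = 0F ∷ 1F ∷ 2F ∷ 3F ∷ []

  crossing : (τ : Permutation′ 4) {_ : True (alternating? (Prefix τ 1F) (prefix? τ 1F) identity)} →
    ∃ λ j → Crossing (Prefix τ j)
  crossing τ {alt} =
    -- Positions count from zero, so `1F` selects the first two entries, which are 1 and 3 or 2 and
    -- 4 in some order. Deciding `Alternating` on all four values settles each pattern by
    -- evaluation.
    1F , identity , ≤-refl ∷ ≤-refl ∷ ≤-refl ∷ [-] , toWitness alt

module _ {n} (π : Permutation′ n) (j : Fin n) where

  -- Supplies the middle link of each chain of positions below, from the pair inside the prefix to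
  -- the pair outside.
  prefix-< : ∀ {x y} → Prefix π j x → ¬ Prefix π j y → π ⟨$⟩ˡ x < π ⟨$⟩ˡ y
  prefix-< {x} {y} px ¬py =
    ≤-<-trans (from (prefix⇔ π j x) px) (≰⇒> (¬py ∘ to (prefix⇔ π j y)))

  <⇒positions-ordered : ∀ {x y} → x < y → π ⟨$⟩ˡ x < π ⟨$⟩ˡ y ⊎ π ⟨$⟩ˡ y < π ⟨$⟩ˡ x
  <⇒positions-ordered {x} {y} x<y with <-cmp (π ⟨$⟩ˡ x) (π ⟨$⟩ˡ y)
  ... | tri< lt _ _ = inj₁ lt
  ... | tri> _ _ gt = inj₂ gt
  ... | tri≈ _ eq _ = contradiction x<y
    (<-irrefl (trans (sym (inverseʳ π)) (trans (cong (π ⟨$⟩ʳ_) eq) (inverseʳ π))))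

  -- The values `w`, `x`, `y`, `z` act as 1, 2, 3, 4. Three binary choices, namely the order of
  -- positions within `w`, `y`, that within `x`, `z`, and which pair lies in the prefix and so comes
  -- first, give the eight patterns, one each.
  crossing⇒pattern : Crossing (Prefix π j) → Any (Contains π ∘ proj₂) patterns
  crossing⇒pattern (v@(w ∷ x ∷ y ∷ z ∷ []) , v↗@(w<x ∷ x<y ∷ y<z ∷ [-]) , alt) =
    case (<⇒positions-ordered (<-trans w<x x<y)) (<⇒positions-ordered (<-trans x<y y<z)) alt
    where
    case : π ⟨$⟩ˡ w < π ⟨$⟩ˡ y ⊎ π ⟨$⟩ˡ y < π ⟨$⟩ˡ w →
           π ⟨$⟩ˡ x < π ⟨$⟩ˡ z ⊎ π ⟨$⟩ˡ z < π ⟨$⟩ˡ x →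
           Alternating (Prefix π j) v → Any (Contains π ∘ proj₂) patterns
    case (inj₁ w<y) (inj₁ x<z) (inj₁ (pw , ¬px , py , ¬pz)) =
      here (contains⁺ π (proj₂ p1324) v v↗ (w<y ∷ prefix-< py ¬px ∷ x<z ∷ [-]))
    case (inj₁ w<y) (inj₂ z<x) (inj₁ (pw , ¬px , py , ¬pz)) =
      there (here (contains⁺ π (proj₂ p1342) v v↗ (w<y ∷ prefix-< py ¬pz ∷ z<x ∷ [-])))
    case (inj₁ w<y) (inj₁ x<z) (inj₂ (¬pw , px , ¬py , pz)) =
      there (there (here (contains⁺ π (proj₂ p2413) v v↗ (x<z ∷ prefix-< pz ¬pw ∷ w<y ∷ [-]))))
    case (inj₂ y<w) (inj₁ x<z) (inj₂ (¬pw , px , ¬py , pz)) =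
      there (there (there (here
        (contains⁺ π (proj₂ p2431) v v↗ (x<z ∷ prefix-< pz ¬py ∷ y<w ∷ [-])))))
    case (inj₂ y<w) (inj₁ x<z) (inj₁ (pw , ¬px , py , ¬pz)) =
      there (there (there (there (here
        (contains⁺ π (proj₂ p3124) v v↗ (y<w ∷ prefix-< pw ¬px ∷ x<z ∷ [-]))))))
    case (inj₂ y<w) (inj₂ z<x) (inj₁ (pw , ¬px , py , ¬pz)) =
      there (there (there (there (there (here
        (contains⁺ π (proj₂ p3142) v v↗ (y<w ∷ prefix-< pw ¬pz ∷ z<x ∷ [-])))))))
    case (inj₁ w<y) (inj₂ z<x) (inj₂ (¬pw , px , ¬py , pz)) =
      there (there (there (there (there (there (here
        (contains⁺ π (proj₂ p4213) v v↗ (z<x ∷ prefix-< px ¬pw ∷ w<y ∷ [-]))))))))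
    case (inj₂ y<w) (inj₂ z<x) (inj₂ (¬pw , px , ¬py , pz)) =
      there (there (there (there (there (there (there (here
        (contains⁺ π (proj₂ p4231) v v↗ (z<x ∷ prefix-< px ¬py ∷ y<w ∷ [-])))))))))

theorem3p2 : (n : ℕ) → n ≥ 1 →
    𝒜 n ≐ 𝒮 n (p1324 ∷ p1342 ∷ p2413 ∷ p2431 ∷ p3124 ∷ p3142 ∷ p4213 ∷ p4231 ∷ [])
theorem3p2 n _ =
  (λ {π} arc → All.map (λ {(_ , τ)} cross contains →
    let j , crossπ = crossing-contains {π = π} {τ} contains cross
    in interval⇒¬crossing (arc j) crossπ) patterns-crossing) ,
  -- An interval is nonempty by definition; the prefix contains the value of `π` at `j`.
  (λ {π} avoids j → ¬crossing⇒interval (prefix? π j) (π ⟨$⟩ʳ j , j , ≤-refl , refl)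
    (All¬⇒¬Any avoids ∘ crossing⇒pattern π j))
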